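{- For every nested sequent $\Gamma$, $\Gamma$ is derivable in $\mathbf{SS4}$ if and only if $\Gamma$ is derivable in $\mathbf{DS4}$.
   Context: Formulae are in negation normal form over $a,\neg a,\lor,\land,\square,\blacksquare,\lozenge,\lozenge^{\bullet}$ ($\lozenge^{\bullet}$ the past diamond, dual of $\blacksquare$). Nested sequents are multisets of formulae and structures $\circ\{\Gamma\}$, $\bullet\{\Delta\}$; $\Sigma[\,]$ is a context with a hole at any depth. $\mathbf{SKt}$ is the shallow calculus: $id$ ($\Gamma,a,\overline a$), $cut$, $\land$, $\lor$, $ctr$, $wk$, $rf$ (from $\Gamma,\circ\{\Delta\}$ infer $\bullet\{\Gamma\},\Delta$), $rp$ (from $\Gamma,\bullet\{\Delta\}$ infer $\circ\{\Gamma\},\Delta$), $\blacksquare$ (from $\Gamma,\bullet\{A\}$ infer $\Gamma,\blacksquare A$), $\square$ (from $\Gamma,\circ\{A\}$ infer $\Gamma,\square A$), $\lozenge^{\bullet}$ (from $\Gamma,\bullet\{\Delta,A\}$ infer $\Gamma,\bullet\{\Delta\},\lozenge^{\bullet}A$), $\lozenge$ (from $\Gamma,\circ\{\Delta,A\}$ infer $\Gamma,\circ\{\Delta\},\lozenge A$). $\mathbf{SS4}$ is $\mathbf{SKt}$ plus $T_f$: from $\Gamma,\circ\{\Delta\}$ infer $\Gamma,\Delta$, and $4_f$: from $\Gamma,\circ\{\Delta\}$ infer $\Gamma,\circ\{\circ\{\Delta\}\}$. $\mathbf{DKt}$ is the deep calculus: $id$: $\Sigma[a,\overline a]$; $\land$: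 from $\Sigma[A\land B,A]$, $\Sigma[A\land B,B]$ infer $\Sigma[A\land B]$; $\lor$: from $\Sigma[A\lor B,A,B]$ infer $\Sigma[A\lor B]$; $\blacksquare$: from $\Sigma[\blacksquare A,\bullet\{A\}]$ infer $\Sigma[\blacksquare A]$; $\square$: from $\Sigma[\square A,\circ\{A\}]$ infer $\Sigma[\square A]$; $\lozenge^{\bullet}_1$: from $\Sigma[\bullet\{\Delta,A\},\lozenge^{\bullet}A]$ infer $\Sigma[\bullet\{\Delta\},\lozenge^{\bullet}A]$; $\lozenge^{\bullet}_2$: from $\Sigma[\circ\{\Delta,\lozenge^{\bullet}A\},A]$ infer $\Sigma[\circ\{\Delta,\lozenge^{\bullet}A\}]$; $\lozenge_1$: from $\Sigma[\circ\{\Delta,A\},\lozenge A]$ infer $\Sigma[\circ\{\Delta\},\lozenge A]$; $\lozenge_2$: from $\Sigma[\bullet\{\Delta,\lozenge A\},A]$ infer $\Sigma[\bullet\{\Delta,\lozenge A\}]$. $\mathbf{DS4}$ is $\mathbf{DKt}$ plus: $T_a$: from $\Sigma[\lozenge^{\bullet}A,A]$ infer $\Sigma[\lozenge^{\bullet}A]$; $T_b$: from $\Sigma[\lozenge A,A]$ infer $\Sigma[\lozenge A]$; $4_a$: from $\Sigma[\lozenge^{\bullet}A,\bullet\{\lozenge^{\bullet}A,\Delta\}]$ infer $\Sigma[\lozenge^{\bullet}A,\bullet\{\Delta\}]$; $4_b$: from $\Sigma[\circ\{\Delta,\lozenge^{\bullet}A\},\lozenge^{\bullet}A]$ infer $\Sigma[\circ\{\Delta,\lozenge^{\bullet}A\}]$;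 $4_c$: from $\Sigma[\lozenge A,\circ\{\lozenge A,\Delta\}]$ infer $\Sigma[\lozenge A,\circ\{\Delta\}]$; $4_d$: from $\Sigma[\bullet\{\Delta,\lozenge A\},\lozenge A]$ infer $\Sigma[\bullet\{\Delta,\lozenge A\}]$. -}

module Defs where

open import Data.Nat using (ℕ)
open import Data.List using (List; []; _∷_; _++_)

data Fml : Set where
  at   : ℕ → Fml
  nat  : ℕ → Fml          -- ¬a  (written ā)
  _∨'_ : Fml → Fml → Fml
  _∧'_ : Fml → Fml → Fml
  □    : Fml → Fml        -- future box
  ■    : Fml → Fml        -- past box
  ◇    : Fml → Fml        -- future diamond (dual of □)
  ◆    : Fml → Fml        -- past diamond   (dual of ■)

neg : Fml → Fml
neg (at a)   = nat a
neg (nat a)  = at a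
neg (A ∨' B) = neg A ∧' neg B
neg (A ∧' B) = neg A ∨' neg B
neg (□ A)    = ◇ (neg A)
neg (■ A)    = ◆ (neg A)
neg (◇ A)    = □ (neg A)
neg (◆ A)    = ■ (neg A)

-- Nested sequents: (multi)sets of formulae and structures ∘{Γ}, •{Γ}.
-- Represented as lists; multiset identity is the deep permutation
-- equivalence _≈ₛ_ below, under which both calculi are closed (rule exch).

mutual
  data Item : Set where
    fm : Fml → Item
    ∘⟨_⟩ : List Item → Item
    •⟨_⟩ : List Item → Item

  Seq : Set
  Seq = List Item

mutual
  data _≈ᵢ_ : Item → Item → Set where
    fm≈ : ∀ A → fm A ≈ᵢ fm A
    ∘≈  : ∀ {Γ Δ} → Γ ≈ₛ Δ → ∘⟨ Γ ⟩ ≈ᵢ ∘⟨ Δ ⟩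
    •≈  : ∀ {Γ Δ} → Γ ≈ₛ Δ → •⟨ Γ ⟩ ≈ᵢ •⟨ Δ ⟩

  data _≈ₛ_ : Seq → Seq → Set where
    []≈   : [] ≈ₛ []
    ∷≈    : ∀ {x y xs ys} → x ≈ᵢ y → xs ≈ₛ ys → (x ∷ xs) ≈ₛ (y ∷ ys)
    swap≈ : ∀ x y xs → (x ∷ y ∷ xs) ≈ₛ (y ∷ x ∷ xs)
    trans≈ : ∀ {xs ys zs} → xs ≈ₛ ys → ys ≈ₛ zs → xs ≈ₛ zs

-- Shallow calculus SS4 = SKt + T_f + 4_f.
-- "Γ , X" is written  X ++ Γ  /  x ∷ Γ (order is irrelevant thanks to exch).

data SS4 : Seq → Set where
  exch : ∀ {Γ Δ} → Γ ≈ₛ Δ → SS4 Γ → SS4 Δ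
  id   : ∀ {Γ} a → SS4 (fm (at a) ∷ fm (nat a) ∷ Γ)
  cut  : ∀ {Γ Δ} A → SS4 (fm A ∷ Γ) → SS4 (fm (neg A) ∷ Δ) → SS4 (Γ ++ Δ)
  ∧r   : ∀ {Γ A B} → SS4 (fm A ∷ Γ) → SS4 (fm B ∷ Γ) → SS4 (fm (A ∧' B) ∷ Γ)
  ∨r   : ∀ {Γ A B} → SS4 (fm A ∷ fm B ∷ Γ) → SS4 (fm (A ∨' B) ∷ Γ)
  ctr  : ∀ {Γ Δ} → SS4 (Δ ++ Δ ++ Γ) → SS4 (Δ ++ Γ)
  wk   : ∀ {Γ Δ} → SS4 Γ → SS4 (Δ ++ Γ)
  rf   : ∀ {Γ Δ} → SS4 (∘⟨ Δ ⟩ ∷ Γ) → SS4 (•⟨ Γ ⟩ ∷ Δ)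
  rp   : ∀ {Γ Δ} → SS4 (•⟨ Δ ⟩ ∷ Γ) → SS4 (∘⟨ Γ ⟩ ∷ Δ)
  ■r   : ∀ {Γ A} → SS4 (•⟨ fm A ∷ [] ⟩ ∷ Γ) → SS4 (fm (■ A) ∷ Γ)
  □r   : ∀ {Γ A} → SS4 (∘⟨ fm A ∷ [] ⟩ ∷ Γ) → SS4 (fm (□ A) ∷ Γ)
  ◆r   : ∀ {Γ Δ A} → SS4 (•⟨ fm A ∷ Δ ⟩ ∷ Γ) → SS4 (fm (◆ A) ∷ •⟨ Δ ⟩ ∷ Γ)
  ◇r   : ∀ {Γ Δ A} → SS4 (∘⟨ fm A ∷ Δ ⟩ ∷ Γ) → SS4 (fm (◇ A) ∷ ∘⟨ Δ ⟩ ∷ Γ)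
  Tf   : ∀ {Γ Δ} → SS4 (∘⟨ Δ ⟩ ∷ Γ) → SS4 (Δ ++ Γ)
  4f   : ∀ {Γ Δ} → SS4 (∘⟨ Δ ⟩ ∷ Γ) → SS4 (∘⟨ ∘⟨ Δ ⟩ ∷ [] ⟩ ∷ Γ)

data Ctx : Set where
  hole : Seq → Ctx
  ∘ctx : Seq → Ctx → Ctx
  •ctx : Seq → Ctx → Ctx

_[_] : Ctx → Seq → Seq
hole Γ   [ Δ ] = Δ ++ Γ
∘ctx Γ Σ [ Δ ] = ∘⟨ Σ [ Δ ] ⟩ ∷ Γ
•ctx Γ Σ [ Δ ] = •⟨ Σ [ Δ ] ⟩ ∷ Γ

data DS4 : Seq → Set where
  exch : ∀ {Γ Δ} → Γ ≈ₛ Δ → DS4 Γ → DS4 Δ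
  id   : ∀ Σ a → DS4 (Σ [ fm (at a) ∷ fm (nat a) ∷ [] ])
  ∧d   : ∀ Σ {A B} → DS4 (Σ [ fm (A ∧' B) ∷ fm A ∷ [] ])
                   → DS4 (Σ [ fm (A ∧' B) ∷ fm B ∷ [] ])
                   → DS4 (Σ [ fm (A ∧' B) ∷ [] ])
  ∨d   : ∀ Σ {A B} → DS4 (Σ [ fm (A ∨' B) ∷ fm A ∷ fm B ∷ [] ])
                   → DS4 (Σ [ fm (A ∨' B) ∷ [] ])
  ■d   : ∀ Σ {A} → DS4 (Σ [ fm (■ A) ∷ •⟨ fm A ∷ [] ⟩ ∷ [] ]) → DS4 (Σ [ fm (■ A) ∷ [] ])
  □d   : ∀ Σ {A} → DS4 (Σ [ fm (□ A) ∷ ∘⟨ fm A ∷ [] ⟩ ∷ [] ]) → DS4 (Σ [ fm (□ A) ∷ [] ])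
  ◆₁   : ∀ Σ {Δ A} → DS4 (Σ [ •⟨ fm A ∷ Δ ⟩ ∷ fm (◆ A) ∷ [] ])
                     → DS4 (Σ [ •⟨ Δ ⟩ ∷ fm (◆ A) ∷ [] ])
  ◆₂   : ∀ Σ {Δ A} → DS4 (Σ [ ∘⟨ fm (◆ A) ∷ Δ ⟩ ∷ fm A ∷ [] ])
                     → DS4 (Σ [ ∘⟨ fm (◆ A) ∷ Δ ⟩ ∷ [] ])
  ◇₁   : ∀ Σ {Δ A} → DS4 (Σ [ ∘⟨ fm A ∷ Δ ⟩ ∷ fm (◇ A) ∷ [] ])
                     → DS4 (Σ [ ∘⟨ Δ ⟩ ∷ fm (◇ A) ∷ [] ])
  ◇₂   : ∀ Σ {Δ A} → DS4 (Σ [ •⟨ fm (◇ A) ∷ Δ ⟩ ∷ fm A ∷ [] ])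
                     → DS4 (Σ [ •⟨ fm (◇ A) ∷ Δ ⟩ ∷ [] ])
  Ta   : ∀ Σ {A} → DS4 (Σ [ fm (◆ A) ∷ fm A ∷ [] ]) → DS4 (Σ [ fm (◆ A) ∷ [] ])
  Tb   : ∀ Σ {A} → DS4 (Σ [ fm (◇ A) ∷ fm A ∷ [] ]) → DS4 (Σ [ fm (◇ A) ∷ [] ])
  4a   : ∀ Σ {Δ A} → DS4 (Σ [ fm (◆ A) ∷ •⟨ fm (◆ A) ∷ Δ ⟩ ∷ [] ])
                     → DS4 (Σ [ fm (◆ A) ∷ •⟨ Δ ⟩ ∷ [] ])
  4b   : ∀ Σ {Δ A} → DS4 (Σ [ ∘⟨ fm (◆ A) ∷ Δ ⟩ ∷ fm (◆ A) ∷ [] ])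
                     → DS4 (Σ [ ∘⟨ fm (◆ A) ∷ Δ ⟩ ∷ [] ])
  4c   : ∀ Σ {Δ A} → DS4 (Σ [ fm (◇ A) ∷ ∘⟨ fm (◇ A) ∷ Δ ⟩ ∷ [] ])
                     → DS4 (Σ [ fm (◇ A) ∷ ∘⟨ Δ ⟩ ∷ [] ])
  4d   : ∀ Σ {Δ A} → DS4 (Σ [ •⟨ fm (◇ A) ∷ Δ ⟩ ∷ fm (◇ A) ∷ [] ])
                     → DS4 (Σ [ •⟨ fm (◇ A) ∷ Δ ⟩ ∷ [] ])

{-# OPTIONS --safe #-}

-- From deep to shallow: rf and rp display the hole of any context, and there every deep rule is
-- a shallow one followed by a contraction, with 4 obtained by a cut against its axiom.
--
-- From shallow to deep: semantic cut elimination. The worlds are pointed nested sequents, ordered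
-- by maps of trees that preserve labelled formulae and edges, and absurdity at a world is DS4
-- derivability of its sequent. Reading a formula as "refuted at this node", a formula occurring
-- at a node is refuted there, because each deep rule allows one to add its active part. The
-- shallow rules are sound for this reading; rf and rp merely move the point of evaluation, Tf and
-- 4f are reflexivity and transitivity of reachability. Evaluating at the root of Γ itself, where
-- Γ is refuted, gives a DS4 derivation of Γ.

module Submission where

open import Defs
open import Data.Product using (_×_; _,_; proj₂; ∃-syntax)
open import Data.Unit using (⊤; tt)
open import Data.List using ([]; _∷_; _++_)
open import Data.List.Properties using (++-assoc; ++-identityʳ)
open import Data.List.Membership.Propositional using (_∈_)
open import Data.List.Membership.Propositional.Properties using (∈-++⁺ˡ; ∈-++⁺ʳ)
open import Data.List.Relation.Unary.Any using (here; there; _─_)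
open import Data.List.Relation.Binary.Permutation.Propositional using (_↭_)
import Data.List.Relation.Binary.Permutation.Propositional as Perm
open import Data.List.Relation.Binary.Permutation.Propositional.Properties using (shift; ++-comm)
open import Relation.Binary.Construct.Closure.ReflexiveTransitive using (Star; ε; _◅_; _◅◅_; gmap; reverse)
open import Relation.Binary.PropositionalEquality using (_≡_; refl; sym; subst)

-- Exchange as an equivalence relation, and the two directions

mutual
  ≈ᵢ-refl : ∀ x → x ≈ᵢ x
  ≈ᵢ-refl (fm A)   = fm≈ A
  ≈ᵢ-refl ∘⟨ Γ ⟩ = ∘≈ (≈-refl Γ)
  ≈ᵢ-refl •⟨ Γ ⟩ = •≈ (≈-refl Γ)

  ≈-refl : ∀ Γ → Γ ≈ₛ Γ
  ≈-refl []      = []≈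
  ≈-refl (x ∷ Γ) = ∷≈ (≈ᵢ-refl x) (≈-refl Γ)

mutual
  ≈ᵢ-sym : ∀ {x y} → x ≈ᵢ y → y ≈ᵢ x
  ≈ᵢ-sym (fm≈ A) = fm≈ A
  ≈ᵢ-sym (∘≈ e)  = ∘≈ (≈-sym e)
  ≈ᵢ-sym (•≈ e)  = •≈ (≈-sym e)

  ≈-sym : ∀ {Γ Δ} → Γ ≈ₛ Δ → Δ ≈ₛ Γ
  ≈-sym []≈           = []≈
  ≈-sym (∷≈ e es)     = ∷≈ (≈ᵢ-sym e) (≈-sym es)
  ≈-sym (swap≈ x y Γ) = swap≈ y x Γ
  ≈-sym (trans≈ d e)  = trans≈ (≈-sym e) (≈-sym d)

≈-prep : ∀ x {Γ Δ} → Γ ≈ₛ Δ → (x ∷ Γ) ≈ₛ (x ∷ Δ)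
≈-prep x = ∷≈ (≈ᵢ-refl x)

↭⇒≈ : ∀ {Γ Δ} → Γ ↭ Δ → Γ ≈ₛ Δ
↭⇒≈ Perm.refl            = ≈-refl _
↭⇒≈ (Perm.prep x e)      = ≈-prep x (↭⇒≈ e)
↭⇒≈ (Perm.swap x y e)    = trans≈ (swap≈ x y _) (≈-prep y (≈-prep x (↭⇒≈ e)))
↭⇒≈ (Perm.trans d e)     = trans≈ (↭⇒≈ d) (↭⇒≈ e)

-- Past and future rules are mirror images and residuation swaps them; indexing by a direction lets
-- one derivation serve both.
data Dir : Set where
  future past : Dir

op : Dir → Dir
op future = past
op past   = future

br : Dir → Seq → Item
br future Γ = ∘⟨ Γ ⟩
br past   Γ = •⟨ Γ ⟩

box dia : Dir → Fml → Fml
box future = □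
box past   = ■
dia future = ◇
dia past   = ◆

-- Derived rules of the shallow calculus

perm : ∀ {Γ Δ} → Γ ↭ Δ → SS4 Γ → SS4 Δ
perm e = exch (↭⇒≈ e)

swap : ∀ {x y Γ} → SS4 (x ∷ y ∷ Γ) → SS4 (y ∷ x ∷ Γ)
swap = exch (swap≈ _ _ _)

contract : ∀ {x Γ} → SS4 (x ∷ x ∷ Γ) → SS4 (x ∷ Γ)
contract {x} = ctr {Δ = x ∷ []}

turn : ∀ d {Γ Δ} → SS4 (br d Δ ∷ Γ) → SS4 (br (op d) Γ ∷ Δ)
turn future = rf
turn past   = rp

turn⁻ : ∀ d {Γ Δ} → SS4 (br (op d) Γ ∷ Δ) → SS4 (br d Δ ∷ Γ)
turn⁻ future = rp
turn⁻ past   = rf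

box-intro : ∀ d {A Γ} → SS4 (br d (fm A ∷ []) ∷ Γ) → SS4 (fm (box d A) ∷ Γ)
box-intro future = □r
box-intro past   = ■r

dia-intro : ∀ d {A Δ Γ} → SS4 (br d (fm A ∷ Δ) ∷ Γ) → SS4 (fm (dia d A) ∷ br d Δ ∷ Γ)
dia-intro future = ◇r
dia-intro past   = ◆r

dissolve : ∀ d {Δ Γ} → SS4 (br d Δ ∷ Γ) → SS4 (Δ ++ Γ)
dissolve future         D = Tf D
dissolve past   {Δ} {Γ} D = perm (++-comm Γ Δ) (Tf (rp D))

nest : ∀ d {Δ Γ} → SS4 (br d Δ ∷ Γ) → SS4 (br d (br d Δ ∷ []) ∷ Γ)
nest future D = 4f D
-- `4f` acts only on white brackets, so `rp` first puts `Γ` into one; once it is nested, two uses of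
-- `rf` turn the two white layers around `Γ` into black ones around `Δ`.
nest past   D = rf (swap (rf (4f (rp D))))

necessitate : ∀ d {Γ} → SS4 Γ → SS4 (br d Γ ∷ [])
-- Weakening supplies an empty bracket, which residuation turns inside out.
necessitate d D = turn⁻ d (wk {Δ = br (op d) [] ∷ []} D)

weaken-br : ∀ d Θ {Γ Δ} → SS4 (br d Γ ∷ Δ) → SS4 (br d (Θ ++ Γ) ∷ Δ)
weaken-br d Θ D = turn⁻ d (perm (shift _ Θ _) (wk {Δ = Θ} (turn d D)))

br≈ : ∀ d {Γ Δ} → Γ ≈ₛ Δ → br d Γ ≈ᵢ br d Δ
br≈ future = ∘≈
br≈ past   = •≈

-- Both brackets are weakened to the common content `Γ ++ Γ′`, after which they contract.
merge : ∀ d {Γ Γ′ Δ} → SS4 (br d Γ ∷ br d Γ′ ∷ Δ) → SS4 (br d (Γ ++ Γ′) ∷ Δ)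
merge d {Γ} {Γ′} {Δ} D = contract (weaken-br d Γ (swap
  (exch (∷≈ (br≈ d (↭⇒≈ (++-comm Γ′ Γ))) (≈-refl _)) (weaken-br d Γ′ D))))

or-and : ∀ {A A′ B B′} → SS4 (fm A ∷ fm A′ ∷ []) → SS4 (fm B ∷ fm B′ ∷ []) →
         SS4 (fm (A ∨' B) ∷ fm (A′ ∧' B′) ∷ [])
or-and {A} {B = B} D E = ∨r (perm (++-comm (_ ∷ []) (_ ∷ _ ∷ [])) (∧r
  (perm (++-comm (fm B ∷ []) (_ ∷ _ ∷ [])) (wk {Δ = fm B ∷ []} (swap D)))
  (swap (wk {Δ = fm A ∷ []} (swap E)))))

box-dia : ∀ d {A A′} → SS4 (fm A ∷ fm A′ ∷ []) → SS4 (fm (box d A) ∷ fm (dia d A′) ∷ [])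
box-dia d D = box-intro d (swap (dia-intro d (necessitate d (swap D))))

identity : ∀ A → SS4 (fm A ∷ fm (neg A) ∷ [])
identity (at a)   = id a
identity (nat a)  = swap (id a)
identity (A ∨' B) = or-and (identity A) (identity B)
identity (A ∧' B) = swap (or-and (swap (identity A)) (swap (identity B)))
identity (□ A)    = box-dia future (identity A)
identity (■ A)    = box-dia past (identity A)
identity (◇ A)    = swap (box-dia future (swap (identity A)))
identity (◆ A)    = swap (box-dia past (swap (identity A)))

neg-dia : ∀ d A → neg (dia d A) ≡ box d (neg A)
neg-dia future A = refl
neg-dia past   A = refl

-- The 4 axiom; cutting against it yields the deep 4 rules.
dia-nested : ∀ d A → SS4 (fm (neg (dia d A)) ∷ br (op d) (fm (dia d A) ∷ []) ∷ [])
dia-nested d A = subst (λ B → SS4 (fm B ∷ br (op d) (fm (dia d A) ∷ []) ∷ [])) (sym (neg-dia d A))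
  (box-intro d (swap (turn d (nest d (swap (dia-intro d (necessitate d (identity A))))))))

dia-down : ∀ d {A Δ Γ} → SS4 (br d (fm A ∷ Δ) ∷ fm (dia d A) ∷ Γ) → SS4 (br d Δ ∷ fm (dia d A) ∷ Γ)
dia-down d {A} {Δ} {Γ} D = swap (contract (exch (≈-prep _ (swap≈ _ _ _)) (dia-intro d D)))

-- Residuation exchanges the two ends of an edge, so this is `dia-down` in the opposite direction.
dia-up : ∀ d {A Δ Γ} → SS4 (br d (fm (dia (op d) A) ∷ Δ) ∷ fm A ∷ Γ) →
         SS4 (br d (fm (dia (op d) A) ∷ Δ) ∷ Γ)
dia-up d D = turn⁻ d (dia-down (op d) (turn d D))

-- The whole sequent is boxed, `A` leaves the bracket as a diamond, and reflexivity dissolves the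
-- bracket; the two diamonds then contract.
dia-T : ∀ d {A Γ} → SS4 (fm (dia d A) ∷ fm A ∷ Γ) → SS4 (fm (dia d A) ∷ Γ)
dia-T d {A} {Γ} D = contract (perm (++-comm (_ ∷ Γ) (_ ∷ []))
  (dissolve d (swap (dia-intro d (necessitate d (swap D))))))

-- Residuation brings the inner diamond to the top level, where the cut trades it for a copy inside
-- an `op d` bracket. Merging that bracket with the one around `Γ` and turning back leaves two
-- diamonds side by side, which contract.
dia-4-down : ∀ d {A Δ Γ} → SS4 (fm (dia d A) ∷ br d (fm (dia d A) ∷ Δ) ∷ Γ) →
             SS4 (fm (dia d A) ∷ br d Δ ∷ Γ)
dia-4-down d {A} {Δ} {Γ} D = contract (perm (shift _ (_ ∷ _ ∷ []) Γ) (exch (swap≈ _ _ _)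
  (turn⁻ d (merge (op d) (perm (++-comm (br (op d) (fm (dia d A) ∷ Γ) ∷ Δ) (_ ∷ []))
    (cut (dia d A) (swap (turn d (swap D))) (dia-nested d A)))))))

dia-4-up : ∀ d {A Δ Γ} → SS4 (br d (fm (dia (op d) A) ∷ Δ) ∷ fm (dia (op d) A) ∷ Γ) →
           SS4 (br d (fm (dia (op d) A) ∷ Δ) ∷ Γ)
dia-4-up d D = turn⁻ d (swap (dia-4-down (op d) (swap (turn d D))))

-- Display of the hole, and the translation of deep derivations

-- The sequent seen from the hole of a context.
around : Ctx → Seq → Seq
around (hole Γ)   Θ = Γ ++ Θ
around (∘ctx Γ Σ) Θ = around Σ (•⟨ Γ ++ Θ ⟩ ∷ [])
around (•ctx Γ Σ) Θ = around Σ (∘⟨ Γ ++ Θ ⟩ ∷ [])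

-- Each layer of the context costs one residuation. `Θ` accumulates the layers already peeled off,
-- as the induction on `Σ` requires.
display : ∀ Σ {Δ Θ} → SS4 (Σ [ Δ ] ++ Θ) → SS4 (Δ ++ around Σ Θ)
display (hole Γ) {Δ} {Θ} D = subst SS4 (++-assoc Δ Γ Θ) D
display (∘ctx Γ Σ) D = display Σ (perm (++-comm (_ ∷ []) _) (rf D))
display (•ctx Γ Σ) D = display Σ (perm (++-comm (_ ∷ []) _) (rp D))

undisplay : ∀ Σ {Δ Θ} → SS4 (Δ ++ around Σ Θ) → SS4 (Σ [ Δ ] ++ Θ)
undisplay (hole Γ) {Δ} {Θ} D = subst SS4 (sym (++-assoc Δ Γ Θ)) D
undisplay (∘ctx Γ Σ) D = rp (perm (++-comm _ (_ ∷ [])) (undisplay Σ D))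
undisplay (•ctx Γ Σ) D = rf (perm (++-comm _ (_ ∷ [])) (undisplay Σ D))

-- Reduces a deep rule to its instance at the root with arbitrary side items `Θ`.
in-context₂ : ∀ Σ {Δ₁ Δ₂ Δ′} → (∀ {Θ} → SS4 (Δ₁ ++ Θ) → SS4 (Δ₂ ++ Θ) → SS4 (Δ′ ++ Θ)) →
              SS4 (Σ [ Δ₁ ]) → SS4 (Σ [ Δ₂ ]) → SS4 (Σ [ Δ′ ])
in-context₂ Σ {Δ₁} {Δ₂} {Δ′} r D E = subst SS4 (++-identityʳ (Σ [ Δ′ ]))
  (undisplay Σ {Δ′} (r (display Σ {Δ₁} (subst SS4 (sym (++-identityʳ (Σ [ Δ₁ ]))) D))
                       (display Σ {Δ₂} (subst SS4 (sym (++-identityʳ (Σ [ Δ₂ ]))) E))))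

in-context : ∀ Σ {Δ Δ′} → (∀ {Θ} → SS4 (Δ ++ Θ) → SS4 (Δ′ ++ Θ)) → SS4 (Σ [ Δ ]) → SS4 (Σ [ Δ′ ])
in-context Σ {Δ} {Δ′} r D = in-context₂ Σ {Δ} {Δ} {Δ′} (λ D _ → r D) D D

deep⇒shallow : ∀ {Γ} → DS4 Γ → SS4 Γ
deep⇒shallow (exch e D) = exch e (deep⇒shallow D)
deep⇒shallow (id Σ a) = subst SS4 (++-identityʳ (Σ [ _ ])) (undisplay Σ {fm (at a) ∷ fm (nat a) ∷ []} (id a))
deep⇒shallow (∧d Σ D E) =
  in-context₂ Σ (λ D E → contract (∧r (swap D) (swap E))) (deep⇒shallow D) (deep⇒shallow E)
deep⇒shallow (∨d Σ {A} {B} D) = in-context Σ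
  (λ D → contract (∨r (exch (≈-prep _ (swap≈ _ _ _)) (swap D)))) (deep⇒shallow D)
deep⇒shallow (■d Σ D) = in-context Σ (λ D → contract (■r (swap D))) (deep⇒shallow D)
deep⇒shallow (□d Σ D) = in-context Σ (λ D → contract (□r (swap D))) (deep⇒shallow D)
deep⇒shallow (◆₁ Σ D) = in-context Σ (dia-down past) (deep⇒shallow D)
deep⇒shallow (◆₂ Σ D) = in-context Σ (dia-up future) (deep⇒shallow D)
deep⇒shallow (◇₁ Σ D) = in-context Σ (dia-down future) (deep⇒shallow D)
deep⇒shallow (◇₂ Σ D) = in-context Σ (dia-up past) (deep⇒shallow D)
deep⇒shallow (Ta Σ D) = in-context Σ (dia-T past) (deep⇒shallow D)
deep⇒shallow (Tb Σ D) = in-context Σ (dia-T future) (deep⇒shallow D)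
deep⇒shallow (4a Σ D) = in-context Σ (dia-4-down past) (deep⇒shallow D)
deep⇒shallow (4b Σ D) = in-context Σ (dia-4-up future) (deep⇒shallow D)
deep⇒shallow (4c Σ D) = in-context Σ (dia-4-down future) (deep⇒shallow D)
deep⇒shallow (4d Σ D) = in-context Σ (dia-4-up past) (deep⇒shallow D)

-- Nodes of a nested sequent

mutual
  -- A step down is a membership proof, that is, a position, so equal brackets occurring twice give
  -- different nodes.
  data Node (Γ : Seq) : Set where
    root : Node Γ
    into : ∀ {x} → x ∈ Γ → NodeIn x → Node Γ

  data NodeIn : Item → Set where
    ∘in : ∀ {Γ} → Node Γ → NodeIn ∘⟨ Γ ⟩
    •in : ∀ {Γ} → Node Γ → NodeIn •⟨ Γ ⟩

data Top : Dir → ∀ {x} → NodeIn x → Set where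
  ∘top : ∀ {Γ} → Top future (∘in {Γ} root)
  •top : ∀ {Γ} → Top past (•in {Γ} root)

-- Adj future p q: q is accessible from p; Adj past is the converse relation.
mutual
  data Adj {Γ : Seq} : Dir → Node Γ → Node Γ → Set where
    down   : ∀ {d x n} (m : x ∈ Γ) → Top d n → Adj d root (into m n)
    up     : ∀ {d x n} (m : x ∈ Γ) → Top (op d) n → Adj d (into m n) root
    within : ∀ {d x n n′} (m : x ∈ Γ) → AdjIn d n n′ → Adj d (into m n) (into m n′)

  data AdjIn : Dir → ∀ {x} → NodeIn x → NodeIn x → Set where
    ∘adj : ∀ {d Γ} {p q : Node Γ} → Adj d p q → AdjIn d (∘in p) (∘in q)
    •adj : ∀ {d Γ} {p q : Node Γ} → Adj d p q → AdjIn d (•in p) (•in q)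

op-op : ∀ d → op (op d) ≡ d
op-op future = refl
op-op past   = refl

mutual
  adj-op : ∀ {Γ d} {p q : Node Γ} → Adj d p q → Adj (op d) q p
  adj-op {d = d} (down m t) = up m (subst (λ e → Top e _) (sym (op-op d)) t)
  adj-op (up m t)     = down m t
  adj-op (within m s) = within m (adjIn-op s)

  adjIn-op : ∀ {x d} {n n′ : NodeIn x} → AdjIn d n n′ → AdjIn (op d) n′ n
  adjIn-op (∘adj s) = ∘adj (adj-op s)
  adjIn-op (•adj s) = •adj (adj-op s)

mutual
  items : ∀ {Γ} → Node Γ → Seq
  items {Γ} root   = Γ
  items (into m n) = itemsIn n

  itemsIn : ∀ {x} → NodeIn x → Seq
  itemsIn (∘in p) = items p
  itemsIn (•in p) = items p

mutual
  child : ∀ {Γ d Δ} (p : Node Γ) → br d Δ ∈ items p → ∃[ q ] Adj d p q × items q ≡ Δ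
  child {d = future} root m = into m (∘in root) , down m ∘top , refl
  child {d = past}   root m = into m (•in root) , down m •top , refl
  child (into m n) m′ = let n′ , s , e = childIn n m′ in into m n′ , within m s , e

  childIn : ∀ {x d Δ} (n : NodeIn x) → br d Δ ∈ itemsIn n → ∃[ n′ ] AdjIn d n n′ × itemsIn n′ ≡ Δ
  childIn (∘in p) m = let q , s , e = child p m in ∘in q , ∘adj s , e
  childIn (•in p) m = let q , s , e = child p m in •in q , •adj s , e

-- Insertion at a node and the map of trees it induces

mutual
  -- Each bracket on the way to the node moves to the front of its list, which is the shape of a
  -- filled context.
  insert : ∀ {Γ} → Node Γ → Seq → Seq
  insert {Γ} root       Ξ = Ξ ++ Γ
  insert {Γ} (into m n) Ξ = insertIn n Ξ ∷ (Γ ─ m)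

  insertIn : ∀ {x} → NodeIn x → Seq → Item
  insertIn (∘in p) Ξ = ∘⟨ insert p Ξ ⟩
  insertIn (•in p) Ξ = •⟨ insert p Ξ ⟩

-- Insertion below `m` rebuilds the item at `m` alone; any other position survives as one in
-- `Γ ─ m`.
data Compare {Γ : Seq} {x} (m : x ∈ Γ) : ∀ {y} → y ∈ Γ → Set where
  same  : Compare m m
  other : ∀ {y} {m′ : y ∈ Γ} → y ∈ (Γ ─ m) → Compare m m′

compare : ∀ {Γ : Seq} {x y} (m : x ∈ Γ) (m′ : y ∈ Γ) → Compare m m′
compare (here refl) (here refl) = same
compare (here refl) (there m′)  = other m′
compare (there m)   (here refl) = other (here refl)
compare (there m)   (there m′)  with compare m m′
... | same    = same
... | other k = other (there k)

compare-refl : ∀ {Γ : Seq} {x} (m : x ∈ Γ) → compare m m ≡ same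
compare-refl (here refl) = refl
compare-refl (there m) rewrite compare-refl m = refl

mutual
  extend : ∀ {Γ} (p : Node Γ) Ξ → Node Γ → Node (insert p Ξ)
  extend root       Ξ root = root
  extend root       Ξ (into m n) = into (∈-++⁺ʳ Ξ m) n
  extend (into m n) Ξ root = root
  extend (into m n) Ξ (into m′ n′) with compare m m′
  ... | same    = into (here refl) (extendIn n Ξ n′)
  ... | other k = into (there k) n′

  extendIn : ∀ {x} (n : NodeIn x) Ξ → NodeIn x → NodeIn (insertIn n Ξ)
  extendIn (∘in p) Ξ (∘in q) = ∘in (extend p Ξ q)
  extendIn (•in p) Ξ (•in q) = •in (extend p Ξ q)

extend-top : ∀ {d x} (n : NodeIn x) Ξ {n′} → Top d n′ → Top d (extendIn n Ξ n′)
extend-top (∘in root)       Ξ ∘top = ∘top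
extend-top (∘in (into _ _)) Ξ ∘top = ∘top
extend-top (•in root)       Ξ •top = •top
extend-top (•in (into _ _)) Ξ •top = •top

mutual
  extend-adj : ∀ {Γ d} (p : Node Γ) Ξ {q r} → Adj d q r → Adj d (extend p Ξ q) (extend p Ξ r)
  extend-adj root Ξ (down m t)   = down _ t
  extend-adj root Ξ (up m t)     = up _ t
  extend-adj root Ξ (within m s) = within _ s
  extend-adj (into m n) Ξ (down m′ t) with compare m m′
  ... | same    = down _ (extend-top n Ξ t)
  ... | other k = down _ t
  extend-adj (into m n) Ξ (up m′ t) with compare m m′
  ... | same    = up _ (extend-top n Ξ t)
  ... | other k = up _ t
  extend-adj (into m n) Ξ (within m′ s) with compare m m′
  ... | same    = within _ (extendIn-adj n Ξ s)
  ... | other k = within _ s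

  extendIn-adj : ∀ {x d} (n : NodeIn x) Ξ {n′ n″} → AdjIn d n′ n″ →
                 AdjIn d (extendIn n Ξ n′) (extendIn n Ξ n″)
  extendIn-adj (∘in p) Ξ (∘adj s) = ∘adj (extend-adj p Ξ s)
  extendIn-adj (•in p) Ξ (•adj s) = •adj (extend-adj p Ξ s)

mutual
  -- Restricted to formulae because a bracket around the insertion point is itself changed.
  extend-formula : ∀ {Γ} (p : Node Γ) Ξ q {A} → fm A ∈ items q → fm A ∈ items (extend p Ξ q)
  extend-formula root Ξ root       i = ∈-++⁺ʳ Ξ i
  extend-formula root Ξ (into m n) i = i
  extend-formula (into m n) Ξ root i with compare m i
  -- `same` cannot occur: the item at `m` contains a node, hence is a bracket and no formula.
  ... | other k = there k
  extend-formula (into m n) Ξ (into m′ n′) i with compare m m′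
  ... | same    = extendIn-formula n Ξ n′ i
  ... | other k = i

  extendIn-formula : ∀ {x} (n : NodeIn x) Ξ n′ {A} → fm A ∈ itemsIn n′ →
                     fm A ∈ itemsIn (extendIn n Ξ n′)
  extendIn-formula (∘in p) Ξ (∘in q) = extend-formula p Ξ q
  extendIn-formula (•in p) Ξ (•in q) = extend-formula p Ξ q

mutual
  extend-inserted : ∀ {Γ} (p : Node Γ) Ξ {x} → x ∈ Ξ → x ∈ items (extend p Ξ p)
  extend-inserted root       Ξ i = ∈-++⁺ˡ i
  extend-inserted (into m n) Ξ i rewrite compare-refl m = extendIn-inserted n Ξ i

  extendIn-inserted : ∀ {x} (n : NodeIn x) Ξ {y} → y ∈ Ξ → y ∈ itemsIn (extendIn n Ξ n)
  extendIn-inserted (∘in p) Ξ = extend-inserted p Ξ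
  extendIn-inserted (•in p) Ξ = extend-inserted p Ξ

-- The deep rules at a node

mutual
  context : ∀ {Γ} → Node Γ → Seq → Ctx
  context root Δ = hole Δ
  context {Γ} (into m n) Δ = contextIn n (Γ ─ m) Δ

  contextIn : ∀ {x} → NodeIn x → Seq → Seq → Ctx
  contextIn (∘in p) Γ Δ = ∘ctx Γ (context p Δ)
  contextIn (•in p) Γ Δ = •ctx Γ (context p Δ)

∈⇒≈ : ∀ {Γ x} (m : x ∈ Γ) → Γ ≈ₛ (x ∷ (Γ ─ m))
∈⇒≈ (here refl) = ≈-refl _
∈⇒≈ (there m)   = trans≈ (≈-prep _ (∈⇒≈ m)) (swap≈ _ _ _)

pull : ∀ {Γ x y} (m : x ∈ Γ) → (y ∷ Γ) ≈ₛ (x ∷ y ∷ (Γ ─ m))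
pull m = trans≈ (≈-prep _ (∈⇒≈ m)) (swap≈ _ _ _)

context-≈ : ∀ {Γ} (p : Node Γ) Ξ {Δ Δ′} → (Ξ ++ items p) ≈ₛ (Δ′ ++ Δ) →
            insert p Ξ ≈ₛ (context p Δ [ Δ′ ])
context-≈ root             Ξ e = e
context-≈ (into m (∘in p)) Ξ e = ∷≈ (∘≈ (context-≈ p Ξ e)) (≈-refl _)
context-≈ (into m (•in p)) Ξ e = ∷≈ (•≈ (context-≈ p Ξ e)) (≈-refl _)

insert-[] : ∀ {Γ} (p : Node Γ) → insert p [] ≈ₛ Γ
insert-[] root             = ≈-refl _
insert-[] (into m (∘in p)) = trans≈ (∷≈ (∘≈ (insert-[] p)) (≈-refl _)) (≈-sym (∈⇒≈ m))
insert-[] (into m (•in p)) = trans≈ (∷≈ (•≈ (insert-[] p)) (≈-refl _)) (≈-sym (∈⇒≈ m))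

-- One context serves the conclusion and the premises alike, so each rule at a node is a deep rule
-- between exchanges.
focus : ∀ {Γ x} (p : Node Γ) → x ∈ items p →
        ∃[ Σ ] (Σ [ x ∷ [] ]) ≈ₛ Γ × (∀ Ξ → insert p Ξ ≈ₛ (Σ [ x ∷ Ξ ]))
focus p m =
  context p (items p ─ m) ,
  trans≈ (≈-sym (context-≈ p [] (∈⇒≈ m))) (insert-[] p) ,
  λ Ξ → context-≈ p Ξ (trans≈ (≈-++ Ξ (∈⇒≈ m)) (↭⇒≈ (shift _ Ξ _)))
  where
  ≈-++ : ∀ Ξ {Δ Δ′} → Δ ≈ₛ Δ′ → (Ξ ++ Δ) ≈ₛ (Ξ ++ Δ′)
  ≈-++ []      e = e
  ≈-++ (x ∷ Ξ) e = ≈-prep x (≈-++ Ξ e)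

axiom : ∀ {Γ a} (p : Node Γ) → fm (at a) ∈ items p → fm (nat a) ∈ items p → DS4 Γ
axiom p i j with compare i j
... | other k = exch (trans≈ (≈-sym (context-≈ p []
  {Δ′ = _ ∷ _ ∷ []} (trans≈ (∈⇒≈ i) (≈-prep _ (∈⇒≈ k))))) (insert-[] p)) (id (context p _) _)

at-∧ : ∀ {Γ A B} (p : Node Γ) → fm (A ∧' B) ∈ items p →
       DS4 (insert p (fm A ∷ [])) → DS4 (insert p (fm B ∷ [])) → DS4 Γ
at-∧ p m D E = let Σ , e , f = focus p m in exch e (∧d Σ (exch (f _) D) (exch (f _) E))

at-∨ : ∀ {Γ A B} (p : Node Γ) → fm (A ∨' B) ∈ items p →
       DS4 (insert p (fm A ∷ fm B ∷ [])) → DS4 Γ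
at-∨ p m D = let Σ , e , f = focus p m in exch e (∨d Σ (exch (f _) D))

at-box : ∀ d {Γ A} (p : Node Γ) → fm (box d A) ∈ items p →
         DS4 (insert p (br d (fm A ∷ []) ∷ [])) → DS4 Γ
at-box future p m D = let Σ , e , f = focus p m in exch e (□d Σ (exch (f _) D))
at-box past   p m D = let Σ , e , f = focus p m in exch e (■d Σ (exch (f _) D))

at-dia-T : ∀ d {Γ A} (p : Node Γ) → fm (dia d A) ∈ items p → DS4 (insert p (fm A ∷ [])) → DS4 Γ
at-dia-T future p m D = let Σ , e , f = focus p m in exch e (Tb Σ (exch (f _) D))
at-dia-T past   p m D = let Σ , e , f = focus p m in exch e (Ta Σ (exch (f _) D))

-- The two shapes a diamond can have along an edge into q, as in the rules 4c/4a and 4d/4b.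
data EdgeView (d : Dir) {Γ : Seq} (q : Node Γ) (x : Item) : Set where
  downward : ∀ Σ Δ → (Σ [ x ∷ br d Δ ∷ [] ]) ≈ₛ Γ →
             (∀ y → insert q (y ∷ []) ≈ₛ (Σ [ x ∷ br d (y ∷ Δ) ∷ [] ])) → EdgeView d q x
  upward   : ∀ Σ Δ → (Σ [ br (op d) (x ∷ Δ) ∷ [] ]) ≈ₛ Γ →
             (∀ y → insert q (y ∷ []) ≈ₛ (Σ [ br (op d) (x ∷ Δ) ∷ y ∷ [] ])) → EdgeView d q x

edge-view : ∀ {d Γ A} {p q : Node Γ} → Adj d p q → fm A ∈ items p → EdgeView d q (fm A)
edge-view (down m t) i with compare m i
edge-view (down m ∘top) i | other k = downward (hole (_ ─ k)) _
  (≈-sym (trans≈ (∈⇒≈ m) (pull k))) (λ y → pull k)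
edge-view (down m •top) i | other k = downward (hole (_ ─ k)) _
  (≈-sym (trans≈ (∈⇒≈ m) (pull k))) (λ y → pull k)
edge-view {future} (up m •top) i = upward (hole (_ ─ m)) (_ ─ i)
  (trans≈ (∷≈ (•≈ (≈-sym (∈⇒≈ i))) (≈-refl _)) (≈-sym (∈⇒≈ m)))
  (λ y → trans≈ (pull m) (∷≈ (•≈ (∈⇒≈ i)) (≈-refl _)))
edge-view {past} (up m ∘top) i = upward (hole (_ ─ m)) (_ ─ i)
  (trans≈ (∷≈ (∘≈ (≈-sym (∈⇒≈ i))) (≈-refl _)) (≈-sym (∈⇒≈ m)))
  (λ y → trans≈ (pull m) (∷≈ (∘≈ (∈⇒≈ i)) (≈-refl _)))
edge-view (within m (∘adj s)) i with edge-view s i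
... | downward Σ Δ e f = downward (∘ctx (_ ─ m) Σ) Δ
  (trans≈ (∷≈ (∘≈ e) (≈-refl _)) (≈-sym (∈⇒≈ m))) (λ y → ∷≈ (∘≈ (f y)) (≈-refl _))
... | upward Σ Δ e f = upward (∘ctx (_ ─ m) Σ) Δ
  (trans≈ (∷≈ (∘≈ e) (≈-refl _)) (≈-sym (∈⇒≈ m))) (λ y → ∷≈ (∘≈ (f y)) (≈-refl _))
edge-view (within m (•adj s)) i with edge-view s i
... | downward Σ Δ e f = downward (•ctx (_ ─ m) Σ) Δ
  (trans≈ (∷≈ (•≈ e) (≈-refl _)) (≈-sym (∈⇒≈ m))) (λ y → ∷≈ (•≈ (f y)) (≈-refl _))
... | upward Σ Δ e f = upward (•ctx (_ ─ m) Σ) Δ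
  (trans≈ (∷≈ (•≈ e) (≈-refl _)) (≈-sym (∈⇒≈ m))) (λ y → ∷≈ (•≈ (f y)) (≈-refl _))

at-dia-4 : ∀ d {Γ A} {p q : Node Γ} → Adj d p q → fm (dia d A) ∈ items p →
           DS4 (insert q (fm (dia d A) ∷ [])) → DS4 Γ
at-dia-4 d s m D with edge-view s m
at-dia-4 future s m D | downward Σ Δ e f = exch e (4c Σ (exch (f _) D))
at-dia-4 past   s m D | downward Σ Δ e f = exch e (4a Σ (exch (f _) D))
at-dia-4 future s m D | upward Σ Δ e f = exch e (4d Σ (exch (f _) D))
at-dia-4 past   s m D | upward Σ Δ e f = exch e (4b Σ (exch (f _) D))

-- Forcing over pointed nested sequents

record _⇒_ (Γ Γ′ : Seq) : Set where
  field
    node    : Node Γ → Node Γ′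
    formula : ∀ p {A} → fm A ∈ items p → fm A ∈ items (node p)
    adj     : ∀ {d p q} → Adj d p q → Adj d (node p) (node q)
open _⇒_

id⇒ : ∀ {Γ} → Γ ⇒ Γ
id⇒ = record { node = λ p → p ; formula = λ _ i → i ; adj = λ s → s }

_∘⇒_ : ∀ {Γ Γ′ Γ″} → Γ′ ⇒ Γ″ → Γ ⇒ Γ′ → Γ ⇒ Γ″
g ∘⇒ f = record
  { node    = λ p → node g (node f p)
  ; formula = λ p i → formula g (node f p) (formula f p i)
  ; adj     = λ s → adj g (adj f s) }

insert⇒ : ∀ {Γ} (p : Node Γ) Ξ → Γ ⇒ insert p Ξ
insert⇒ p Ξ = record { node = extend p Ξ ; formula = extend-formula p Ξ ; adj = extend-adj p Ξ }

Pred : Set₁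
Pred = ∀ {Γ} → Node Γ → Set

_⊆_ : Pred → Pred → Set
X ⊆ Y = ∀ {Γ} (p : Node Γ) → X p → Y p

-- Kripke negation along `⇒`, with derivability of the target sequent as falsum.
_ᶜ : Pred → Pred
(X ᶜ) {Γ} p = ∀ {Γ′} (f : Γ ⇒ Γ′) → X (node f p) → DS4 Γ′

_∩_ : Pred → Pred → Pred
(X ∩ Y) p = X p × Y p

-- The edges of the tree form a Kt frame; their reflexive transitive closure makes it an S4 frame.
Reach : Dir → Pred → Pred
Reach d X p = ∃[ q ] Star (Adj d) p q × X q

Has : Fml → Pred
Has A p = fm A ∈ items p

-- ref A p says that A is refuted at p, negation being orthogonality with respect to derivability.
-- Each clause has the form X ᶜ, which makes ref A monotone and stable under double complement.
ref : Fml → Pred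
ref (at a)   = Has (nat a) ᶜ
ref (nat a)  = (Has (nat a) ᶜ) ᶜ
ref (A ∨' B) = ((ref A ∩ ref B) ᶜ) ᶜ
ref (A ∧' B) = ((ref A ᶜ) ∩ (ref B ᶜ)) ᶜ
ref (□ A)    = (Reach future (ref A) ᶜ) ᶜ
ref (■ A)    = (Reach past (ref A) ᶜ) ᶜ
ref (◇ A)    = Reach future (ref A ᶜ) ᶜ
ref (◆ A)    = Reach past (ref A ᶜ) ᶜ

-- Monotonicity, closure and duality of refutation

Monotone : Pred → Set
Monotone X = ∀ {Γ Γ′} (f : Γ ⇒ Γ′) (p : Node Γ) → X p → X (node f p)

ᶜ-mono : ∀ (X : Pred) → Monotone (X ᶜ)
ᶜ-mono X f p h g = h (g ∘⇒ f)

∩-mono : ∀ (X Y : Pred) → Monotone X → Monotone Y → Monotone (X ∩ Y)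
∩-mono X Y x y f p (h , k) = x f p h , y f p k

Reach-mono : ∀ d (X : Pred) → Monotone X → Monotone (Reach d X)
Reach-mono d X x f p (q , s , h) = node f q , gmap (node f) (adj f) s , x f q h

ref-mono : ∀ A → Monotone (ref A)
ref-mono (at a)   = ᶜ-mono (Has (nat a))
ref-mono (nat a)  = ᶜ-mono (Has (nat a) ᶜ)
ref-mono (A ∨' B) = ᶜ-mono ((ref A ∩ ref B) ᶜ)
ref-mono (A ∧' B) = ᶜ-mono ((ref A ᶜ) ∩ (ref B ᶜ))
ref-mono (□ A)    = ᶜ-mono (Reach future (ref A) ᶜ)
ref-mono (■ A)    = ᶜ-mono (Reach past (ref A) ᶜ)
ref-mono (◇ A)    = ᶜ-mono (Reach future (ref A ᶜ))
ref-mono (◆ A)    = ᶜ-mono (Reach past (ref A ᶜ))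

ᶜ-anti : ∀ (X Y : Pred) → X ⊆ Y → (Y ᶜ) ⊆ (X ᶜ)
ᶜ-anti X Y i p h f x = h f (i _ x)

ᶜᶜᶜ⊆ᶜ : ∀ (X : Pred) → Monotone X → (((X ᶜ) ᶜ) ᶜ) ⊆ (X ᶜ)
ᶜᶜᶜ⊆ᶜ X mono p h f x = h f (λ g k → k id⇒ (mono g _ x))

Reach-⊆ : ∀ d (X Y : Pred) → X ⊆ Y → Reach d X ⊆ Reach d Y
Reach-⊆ d X Y i p (q , s , h) = q , s , i q h

ref-closed : ∀ A → ((ref A ᶜ) ᶜ) ⊆ ref A
ref-closed (at a)   = ᶜᶜᶜ⊆ᶜ (Has (nat a)) (λ f p → formula f p)
ref-closed (nat a)  = ᶜᶜᶜ⊆ᶜ (Has (nat a) ᶜ) (ᶜ-mono (Has (nat a)))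
ref-closed (A ∨' B) = ᶜᶜᶜ⊆ᶜ ((ref A ∩ ref B) ᶜ) (ᶜ-mono (ref A ∩ ref B))
ref-closed (A ∧' B) = ᶜᶜᶜ⊆ᶜ ((ref A ᶜ) ∩ (ref B ᶜ))
  (∩-mono (ref A ᶜ) (ref B ᶜ) (ᶜ-mono (ref A)) (ᶜ-mono (ref B)))
ref-closed (□ A)    = ᶜᶜᶜ⊆ᶜ (Reach future (ref A) ᶜ) (ᶜ-mono (Reach future (ref A)))
ref-closed (■ A)    = ᶜᶜᶜ⊆ᶜ (Reach past (ref A) ᶜ) (ᶜ-mono (Reach past (ref A)))
ref-closed (◇ A)    = ᶜᶜᶜ⊆ᶜ (Reach future (ref A ᶜ)) (Reach-mono future (ref A ᶜ) (ᶜ-mono (ref A)))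
ref-closed (◆ A)    = ᶜᶜᶜ⊆ᶜ (Reach past (ref A ᶜ)) (Reach-mono past (ref A ᶜ) (ᶜ-mono (ref A)))

mutual
  -- The semantic content of cut. Disjunctions and boxes need the converse inclusion `ref-negᶜ⊆ref`
  -- for their components; it follows by contraposition, since `ref A` is closed under double
  -- complement.
  refᶜ⊆ref-neg : ∀ A → (ref A ᶜ) ⊆ ref (neg A)
  refᶜ⊆ref-neg (at a)   p h = h
  refᶜ⊆ref-neg (nat a)  = ᶜᶜᶜ⊆ᶜ (Has (nat a)) (λ f p → formula f p)
  refᶜ⊆ref-neg (A ∨' B) p h = ᶜ-anti ((ref (neg A) ᶜ) ∩ (ref (neg B) ᶜ)) (ref A ∩ ref B)
    (λ q (k , l) → ref-negᶜ⊆ref A q k , ref-negᶜ⊆ref B q l) p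
    (ᶜᶜᶜ⊆ᶜ (ref A ∩ ref B) (∩-mono (ref A) (ref B) (ref-mono A) (ref-mono B)) p h)
  refᶜ⊆ref-neg (A ∧' B) = ᶜ-anti (X ᶜ) (Y ᶜ) (ᶜ-anti Y X
    (λ q (k , l) → refᶜ⊆ref-neg A q k , refᶜ⊆ref-neg B q l))
    where
    X Y : Pred
    X = ref (neg A) ∩ ref (neg B)
    Y = (ref A ᶜ) ∩ (ref B ᶜ)
  refᶜ⊆ref-neg (□ A)    = box-dual future A
  refᶜ⊆ref-neg (■ A)    = box-dual past A
  refᶜ⊆ref-neg (◇ A)    = dia-dual future A
  refᶜ⊆ref-neg (◆ A)    = dia-dual past A

  ref-negᶜ⊆ref : ∀ A → (ref (neg A) ᶜ) ⊆ ref A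
  ref-negᶜ⊆ref A p h = ref-closed A p (ᶜ-anti (ref A ᶜ) (ref (neg A)) (refᶜ⊆ref-neg A) p h)

  box-dual : ∀ d A → (((Reach d (ref A) ᶜ) ᶜ) ᶜ) ⊆ (Reach d (ref (neg A) ᶜ) ᶜ)
  box-dual d A p h = ᶜ-anti (Reach d (ref (neg A) ᶜ)) (Reach d (ref A))
    (Reach-⊆ d (ref (neg A) ᶜ) (ref A) (ref-negᶜ⊆ref A)) p
    (ᶜᶜᶜ⊆ᶜ (Reach d (ref A)) (Reach-mono d (ref A) (ref-mono A)) p h)

  dia-dual : ∀ d A → ((Reach d (ref A ᶜ) ᶜ) ᶜ) ⊆ ((Reach d (ref (neg A)) ᶜ) ᶜ)
  dia-dual d A = ᶜ-anti (Reach d (ref (neg A)) ᶜ) (Reach d (ref A ᶜ) ᶜ)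
    (ᶜ-anti (Reach d (ref A ᶜ)) (Reach d (ref (neg A)))
      (Reach-⊆ d (ref A ᶜ) (ref (neg A)) (refᶜ⊆ref-neg A)))

-- Following a path, 4 carries the diamond along each edge and T opens it at the end.
propagate : ∀ d (A : Fml) → Has A ⊆ ref A → ∀ {Γ Γ′} {p q : Node Γ} → Star (Adj d) p q →
            (f : Γ ⇒ Γ′) → Has (dia d A) (node f p) → (ref A ᶜ) (node f q) → DS4 Γ′
propagate d A has⊆ {p = p} ε f i k =
  at-dia-T d (node f p) i (k (insert⇒ (node f p) _) (has⊆ _ (extend-inserted (node f p) _ (here refl))))
propagate d A has⊆ (_◅_ {j = r} s ss) f i k =
  at-dia-4 d (adj f s) i
    (propagate d A has⊆ ss (insert⇒ (node f r) _ ∘⇒ f)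
      (extend-inserted (node f r) _ (here refl)) (λ g → k (g ∘⇒ insert⇒ (node f r) _)))

mutual
  -- The truth lemma. The assumed complement is applied to the sequent with the active formulae
  -- inserted, and the matching deep rule leads back. A positive atom is the axiom; a negated one is
  -- the unit of double complement.
  has⊆ref : ∀ A → Has A ⊆ ref A
  has⊆ref (at a)   p i f j = axiom (node f p) (formula f p i) j
  has⊆ref (nat a)  p i f h = h id⇒ (formula f p i)
  has⊆ref (A ∨' B) p i f h = at-∨ (node f p) (formula f p i)
    (h (insert⇒ (node f p) _)
      ( has⊆ref A _ (extend-inserted (node f p) _ (here refl))
      , has⊆ref B _ (extend-inserted (node f p) _ (there (here refl)))))
  has⊆ref (A ∧' B) p i f (h , k) = at-∧ (node f p) (formula f p i)
    (h (insert⇒ (node f p) _) (has⊆ref A _ (extend-inserted (node f p) _ (here refl))))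
    (k (insert⇒ (node f p) _) (has⊆ref B _ (extend-inserted (node f p) _ (here refl))))
  has⊆ref (□ A)    = has-box⊆ future A
  has⊆ref (■ A)    = has-box⊆ past A
  has⊆ref (◇ A)    = has-dia⊆ future A
  has⊆ref (◆ A)    = has-dia⊆ past A

  has-box⊆ : ∀ d A → Has (box d A) ⊆ ((Reach d (ref A) ᶜ) ᶜ)
  has-box⊆ d A p i f h =
    let r = node f p
        -- The node that refutes `A` is the bracket just inserted, one edge away from `r`.
        q , s , e = child (extend r _ r) (extend-inserted r (br d (fm A ∷ []) ∷ []) (here refl))
    in at-box d r (formula f p i)
         (h (insert⇒ r (br d (fm A ∷ []) ∷ [])) (q , s ◅ ε , has⊆ref A q (subst (fm A ∈_) (sym e) (here refl))))

  has-dia⊆ : ∀ d A → Has (dia d A) ⊆ (Reach d (ref A ᶜ) ᶜ)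
  has-dia⊆ d A p i f (q , s , h) = propagate d A (has⊆ref A) s id⇒ (formula f p i) h

-- Refutation of sequents and soundness of the shallow rules

mutual
  -- A sequent is a disjunction and a bracket a box, so all items must be refuted. Unlike `ref` of a
  -- box, a bracket carries no double complement, so `sound` has the reachable node at hand.
  refItem : Item → Pred
  refItem (fm A)   = ref A
  refItem ∘⟨ Γ ⟩ = Reach future (refSeq Γ)
  refItem •⟨ Γ ⟩ = Reach past (refSeq Γ)

  refSeq : Seq → Pred
  refSeq []      p = ⊤
  refSeq (x ∷ Γ) p = refItem x p × refSeq Γ p

mutual
  refItem-mono : ∀ x → Monotone (refItem x)
  refItem-mono (fm A)   = ref-mono A
  refItem-mono ∘⟨ Γ ⟩ = Reach-mono future (refSeq Γ) (refSeq-mono Γ)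
  refItem-mono •⟨ Γ ⟩ = Reach-mono past (refSeq Γ) (refSeq-mono Γ)

  refSeq-mono : ∀ Γ → Monotone (refSeq Γ)
  refSeq-mono []      f p _       = tt
  refSeq-mono (x ∷ Γ) f p (h , k) = refItem-mono x f p h , refSeq-mono Γ f p k

mutual
  refItem-≈ : ∀ {x y} → x ≈ᵢ y → refItem y ⊆ refItem x
  refItem-≈ (fm≈ A)         p h = h
  refItem-≈ (∘≈ {Γ} {Δ} e) = Reach-⊆ future (refSeq Δ) (refSeq Γ) (refSeq-≈ e)
  refItem-≈ (•≈ {Γ} {Δ} e) = Reach-⊆ past (refSeq Δ) (refSeq Γ) (refSeq-≈ e)

  refSeq-≈ : ∀ {Γ Δ} → Γ ≈ₛ Δ → refSeq Δ ⊆ refSeq Γ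
  refSeq-≈ []≈           p h           = h
  refSeq-≈ (∷≈ e es)     p (h , k)     = refItem-≈ e p h , refSeq-≈ es p k
  refSeq-≈ (swap≈ x y Γ) p (h , k , l) = k , h , l
  refSeq-≈ (trans≈ d e)  p h           = refSeq-≈ d p (refSeq-≈ e p h)

refSeq-++⁻ : ∀ Γ {Δ} {Θ} {p : Node Θ} → refSeq (Γ ++ Δ) p → refSeq Γ p × refSeq Δ p
refSeq-++⁻ []      h       = tt , h
refSeq-++⁻ (x ∷ Γ) (h , k) = let l , r = refSeq-++⁻ Γ k in (h , l) , r

refSeq-++⁺ : ∀ Γ {Δ} {Θ} {p : Node Θ} → refSeq Γ p → refSeq Δ p → refSeq (Γ ++ Δ) p
refSeq-++⁺ []      _       k = k
refSeq-++⁺ (x ∷ Γ) (h , l) k = h , refSeq-++⁺ Γ l k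

reverse-path : ∀ d {Γ} {p q : Node Γ} → Star (Adj d) p q → Star (Adj (op d)) q p
reverse-path d = reverse adj-op

sound : ∀ {Γ} → SS4 Γ → ∀ {Θ} (p : Node Θ) → refSeq Γ p → DS4 Θ
sound (exch e D) p h = sound D p (refSeq-≈ e p h)
sound (id a) p (h , k , _) = k id⇒ h
sound (cut {Γ} {Δ} A D E) p h =
  let l , r = refSeq-++⁻ Γ h in
  -- In every extension `D` excludes a refutation of `A`, so `neg A` is refuted at `p` and `E`
  -- applies.
  sound E p (refᶜ⊆ref-neg A p (λ f k → sound D (node f p) (k , refSeq-mono Γ f p l)) , r)
sound (∧r {Γ} D E) p (h , k) = h id⇒
  ( (λ f l → sound D (node f p) (l , refSeq-mono Γ f p k))
  , (λ f l → sound E (node f p) (l , refSeq-mono Γ f p k)))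
sound (∨r {Γ} D) p (h , k) = h id⇒ (λ f (l , r) → sound D (node f p) (l , r , refSeq-mono Γ f p k))
sound (ctr {Γ} {Δ} D) p h = let l , r = refSeq-++⁻ Δ h in
  sound D p (refSeq-++⁺ Δ l (refSeq-++⁺ Δ l r))
sound (wk {Γ} {Δ} D) p h = sound D p (proj₂ (refSeq-++⁻ Δ h))
-- The premise is evaluated at `q`, and the reversed path shows that the content of its bracket is
-- refuted at `p`.
sound (rf D) p ((q , s , h) , k) = sound D q ((p , reverse-path past s , k) , h)
sound (rp D) p ((q , s , h) , k) = sound D q ((p , reverse-path future s , k) , h)
sound (■r {Γ} D) p (h , k) = h id⇒
  (λ f (q , s , l) → sound D (node f p) ((q , s , l , tt) , refSeq-mono Γ f p k))
sound (□r {Γ} D) p (h , k) = h id⇒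
  (λ f (q , s , l) → sound D (node f p) ((q , s , l , tt) , refSeq-mono Γ f p k))
-- The node `q` that refutes `Δ` also serves the diamond: were `A` refuted there in an extension,
-- the bracket of the premise would be refuted as a whole.
sound (◆r {Γ} {Δ} {A} D) p (h , (q , s , l) , k) = h id⇒ (q , s , λ f m →
  sound D (node f p) ((node f q , gmap (node f) (adj f) s , m , refSeq-mono Δ f q l) , refSeq-mono Γ f p k))
sound (◇r {Γ} {Δ} {A} D) p (h , (q , s , l) , k) = h id⇒ (q , s , λ f m →
  sound D (node f p) ((node f q , gmap (node f) (adj f) s , m , refSeq-mono Δ f q l) , refSeq-mono Γ f p k))
sound (Tf {Δ = Δ} D) p h = let l , r = refSeq-++⁻ Δ h in sound D p ((p , ε , l) , r)
sound (4f D) p ((q , s , (r , t , h) , _) , k) = sound D p ((r , s ◅◅ t , h) , k)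

mutual
  -- The inclusion of `Γ` in the items of `p` replaces equality, because the induction shortens `Γ`
  -- while the node stays fixed.
  ref-self : ∀ {Θ} Γ (p : Node Θ) → (∀ {x} → x ∈ Γ → x ∈ items p) → refSeq Γ p
  ref-self []      p i = tt
  ref-self (x ∷ Γ) p i = refItem-self x p (i (here refl)) , ref-self Γ p (λ m → i (there m))

  refItem-self : ∀ {Θ} x (p : Node Θ) → x ∈ items p → refItem x p
  refItem-self (fm A)   p i = has⊆ref A p i
  refItem-self ∘⟨ Γ ⟩ p i =
    let q , s , e = child p i in q , s ◅ ε , ref-self Γ q (subst (_ ∈_) (sym e))
  refItem-self •⟨ Γ ⟩ p i =
    let q , s , e = child p i in q , s ◅ ε , ref-self Γ q (subst (_ ∈_) (sym e))

shallow⇒deep : ∀ {Γ} → SS4 Γ → DS4 Γ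
shallow⇒deep {Γ} D = sound D root (ref-self Γ root (λ i → i))

theorem5p7 : ∀ (Γ : Seq) → (SS4 Γ → DS4 Γ) × (DS4 Γ → SS4 Γ)
theorem5p7 Γ = shallow⇒deep , deep⇒shallow
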